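{- Let $G=(A,B,E)$ be a finite bipartite graph, let $OPT$ be an arbitrary fixed maximum matching of $G$, and let $A_{\text{OPT}}\subseteq A$ be the set of $A$-vertices incident to $OPT$. Consider any execution of the ALT-algorithm on $G$ (described in the context) with parameter $\epsilon>0$, and let $M$, $c(\cdot)$ and $c_{\min}(\cdot)$ denote the current values at the beginning of any iteration. For any integer $k\ge 0$, let $\mathcal{P}$ be an augmenting path of length $2k+1$ in $M\oplus OPT$, and let $a_0\in A_{\text{OPT}}$ be the unmatched $A$-vertex (with respect to $M$) in $\mathcal{P}$. Then $$k\ge c_{\min}(a_0).$$ Furthermore, for any such $k$, the set $M\oplus OPT$ contains at most $\frac{1}{k+1}\cdot|OPT|$ augmenting paths that start at $A_{\text{OPT}}$-vertices $a$ with $c_{\min}(a)\ge k$.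
   Context: A matching is a set of pairwise vertex-disjoint edges; it is maximal (in a graph) if no edge of the graph can be added to it, and maximum if it has the largest possible size. For a matching $N$, $A(N)$ and $B(N)$ denote the sets of $A$-vertices and $B$-vertices incident to edges of $N$. $\Gamma(v)$ denotes the neighbourhood of $v$ in $G$. ALT-algorithm (version without freezing) on $G=(A,B,E)$ with parameter $\epsilon>0$: Initialize $M=\varnothing$ and $c(b)=0$ for all $b\in B$. For each round (iteration) $r=1,2,\ldots,49/\epsilon^2$ (i.e. each integer $r$ with $1\le r\le 49/\epsilon^2$): (i) for every $a\in A\setminus A(M)$ let $c_{\min}(a):=\min\{c(b): b\in\Gamma(a)\}$; (ii) let $H_r\subseteq G$ be the subgraph spanned by all edges $ab\in E$ with $a\in A\setminus A(M)$, $b\in B$ and $c(b)=c_{\min}(a)$ (isolated vertices contribute no edges); (iii) compute an arbitrary maximal matching $N_r$ in $H_r$; (iv) set $M\gets\{ab\in M: b\notin B(N_r)\}\cup N_r$; (v) increase $c(b)$ by $1$ for each $b\in B(N_r)$. Finally return $M$. An execution is determined by the choices of the maximal matchings $N_r$. At any moment, for any $a\in A$ (matched or not) with at least one neighbour, $c_{\min}(a)=\min\{c(b):b\in\Gamma(a)\}$ with the current counters $c$. "Matched"/"unmatched" is with respect to the current $M$. $M\oplus OPT=(M\setminus OPT)\cup(OPT\setminus M)$ is the symmetric difference. An augmenting path in $M\oplus OPT$ is a path consisting of edges of $M\oplus OPT$, alternating between edges of $OPT\setminus M$ and edges of $M\setminus OPT$, whose two endpoints are distinct and both unmatched in $M$;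 its length is its number of edges (thus odd, with one endpoint in $A$ and one in $B$). It is said to start at its endpoint in $A$. -}

module Defs where

open import Data.Bool.Base using (if_then_else_)
open import Data.Empty using (⊥)
open import Data.Fin.Base using (Fin; combine; remQuot)
open import Data.Fin.Properties using (any?)
import Data.Fin.Subset as Subset
open Subset using (Subset; _∈_; _∉_; _⊆_; _∪_; _─_; ⁅_⁆; ∣_∣)
open import Data.Fin.Subset.Properties using (_∈?_)
open import Data.Integer.Base using (+_)
open import Data.List.Base using (List; []; _∷_; map; filter; allFin; length)
open import Data.List.Extrema.Nat using (min)
open import Data.List.NonEmpty.Base using (List⁺; head; tail; last; toList)
open import Data.List.Relation.Unary.Linked using (Linked)
open import Data.List.Relation.Unary.Unique.Propositional using (Unique)
open import Data.Nat.Base as ℕ using (ℕ; suc)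
open import Data.Nat.Properties using (_≟_)
open import Data.Product.Base using (∃; _×_; proj₁; proj₂)
open import Data.Rational.Base using (ℚ; Positive; _≤_; _*_; _÷_; _/_)
open import Data.Rational.Properties using (pos*pos⇒pos; pos⇒nonZero)
open import Data.Sum.Base using (_⊎_; inj₁; inj₂)
open import Data.Vec.Base using (tabulate)
open import Function.Base using (_∘_)
open import Relation.Binary.PropositionalEquality.Core using (_≡_; _≢_)
open import Relation.Nullary.Decidable.Core using (Dec; does; ¬?; _×-dec_)
open import Relation.Nullary.Negation.Core using (¬_)

comprehension : ∀ {n} {P : Fin n → Set} → (∀ i → Dec (P i)) → Subset n
comprehension P? = tabulate (does ∘ P?)

minimum : List ℕ → ℕ
minimum []       = 0
minimum (x ∷ xs) = min x xs

-- The pair ab ∈ A × B is coded as `combine a b : Fin (nA * nB)`, so that edge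
-- sets are subsets of a finite set.
record BipartiteGraph : Set where
  field
    nA nB : ℕ
    E     : Subset (nA ℕ.* nB)

-- 49/ε².  The execution depends on ε only through which r satisfy r ≤ 49/ε²;
-- every r satisfies this for the rational ε = 1/r, so a property of the
-- states at the beginning of each iteration that holds for all rational ε > 0
-- also holds for all real ε > 0.
roundBound : (ε : ℚ) .{{_ : Positive ε}} → ℚ
roundBound ε = ((+ 49) / 1) ÷ (ε * ε)
  where instance _ = pos⇒nonZero (ε * ε) {{pos*pos⇒pos ε ε}}

module ALT (G : BipartiteGraph) where
  open BipartiteGraph G

  EdgeSet : Set
  EdgeSet = Subset (nA ℕ.* nB)

  edge : Fin nA → Fin nB → Fin (nA ℕ.* nB)
  edge = combine

  endA : Fin (nA ℕ.* nB) → Fin nA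
  endA e = proj₁ (remQuot {nA} nB e)

  endB : Fin (nA ℕ.* nB) → Fin nB
  endB e = proj₂ (remQuot {nA} nB e)

  -- A(N) and B(N)
  A⟨_⟩ : EdgeSet → Subset nA
  A⟨ N ⟩ = comprehension λ a → any? λ b → edge a b ∈? N

  B⟨_⟩ : EdgeSet → Subset nB
  B⟨ N ⟩ = comprehension λ b → any? λ a → edge a b ∈? N

  Γ : Fin nA → Subset nB
  Γ a = comprehension λ b → edge a b ∈? E

  VertexDisjoint : EdgeSet → Set
  VertexDisjoint N = ∀ {e f} → e ∈ N → f ∈ N → e ≢ f →
                     endA e ≢ endA f × endB e ≢ endB f

  -- The first argument is the edge set of the ambient graph.
  IsMatching : EdgeSet → EdgeSet → Set
  IsMatching H N = N ⊆ H × VertexDisjoint N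

  IsMaximalMatching : EdgeSet → EdgeSet → Set
  IsMaximalMatching H N =
    IsMatching H N × (∀ {e} → e ∈ H → e ∉ N → ¬ IsMatching H (N ∪ ⁅ e ⁆))

  IsMaximumMatching : EdgeSet → EdgeSet → Set
  IsMaximumMatching H N =
    IsMatching H N × (∀ N′ → IsMatching H N′ → ∣ N′ ∣ ℕ.≤ ∣ N ∣)

  Counter : Set
  Counter = Fin nB → ℕ

  -- When Γ a is empty the minimum does not exist and the value is a dummy 0;
  -- such an a lies on no edge, so the value is never used.
  cmin : Counter → Fin nA → ℕ
  cmin c a = minimum (map c (filter (_∈? Γ a) (allFin nB)))

  record State : Set where
    constructor ⟨_,_⟩
    field
      M : EdgeSet
      c : Counter

  initial : State
  initial = ⟨ Subset.⊥ , (λ _ → 0) ⟩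

  -- The edge set of H_r.
  candidates : State → EdgeSet
  candidates ⟨ M , c ⟩ = comprehension λ e →
    e ∈? E ×-dec ¬? (endA e ∈? A⟨ M ⟩) ×-dec c (endB e) ≟ cmin c (endA e)

  update : State → EdgeSet → State
  update ⟨ M , c ⟩ N =
    ⟨ comprehension (λ e → e ∈? M ×-dec ¬? (endB e ∈? B⟨ N ⟩)) ∪ N
    , (λ b → if does (b ∈? B⟨ N ⟩) then suc (c b) else c b) ⟩

  IsRound : (ε : ℚ) .{{_ : Positive ε}} → ℕ → Set
  IsRound ε r = 1 ℕ.≤ r × (+ r) / 1 ≤ roundBound ε

  -- AtBeginning ε r s: some execution with parameter ε is in state s at the
  -- beginning of round r.
  data AtBeginning (ε : ℚ) .{{_ : Positive ε}} : ℕ → State → Set where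
    start : IsRound ε 1 → AtBeginning ε 1 initial
    round : ∀ {r s N} → AtBeginning ε r s →
            IsMaximalMatching (candidates s) N →
            IsRound ε (suc r) → AtBeginning ε (suc r) (update s N)

  infixl 5 _⊕_
  _⊕_ : EdgeSet → EdgeSet → EdgeSet
  X ⊕ Y = (X ─ Y) ∪ (Y ─ X)

  Vertex : Set
  Vertex = Fin nA ⊎ Fin nB

  Adjacent : EdgeSet → Vertex → Vertex → Set
  Adjacent D (inj₁ a) (inj₂ b) = edge a b ∈ D
  Adjacent D (inj₂ b) (inj₁ a) = edge a b ∈ D
  Adjacent D (inj₁ _) (inj₁ _) = ⊥
  Adjacent D (inj₂ _) (inj₂ _) = ⊥

  Unmatched : EdgeSet → Vertex → Set
  Unmatched M (inj₁ a) = a ∉ A⟨ M ⟩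
  Unmatched M (inj₂ b) = b ∉ B⟨ M ⟩

  -- A path is given by its sequence of vertices.
  IsPath : EdgeSet → List⁺ Vertex → Set
  IsPath D p = Linked (Adjacent D) (toList p) × Unique (toList p)

  pathLength : List⁺ Vertex → ℕ
  pathLength p = length (tail p)

  -- The first edge is in X, the second in Y, the third in X, and so on.
  data Alternates (X Y : EdgeSet) : List Vertex → Set where
    [-] : ∀ {v} → Alternates X Y (v ∷ [])
    _∷_ : ∀ {u v vs} → Adjacent X u v → Alternates Y X (v ∷ vs) →
          Alternates X Y (u ∷ v ∷ vs)

  record IsAugmentingPath (M OPT : EdgeSet) (p : List⁺ Vertex) : Set where
    field
      isPath        : IsPath (M ⊕ OPT) p
      alternates    : Alternates (OPT ─ M) (M ─ OPT) (toList p) ⊎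
                      Alternates (M ─ OPT) (OPT ─ M) (toList p)
      endsDistinct  : head p ≢ last p
      headUnmatched : Unmatched M (head p)
      lastUnmatched : Unmatched M (last p)

  -- An augmenting path has exactly one endpoint in A, so exactly one of its two
  -- vertex sequences satisfies this.
  StartsAt : List⁺ Vertex → Fin nA → Set
  StartsAt p a = head p ≡ inj₁ a

{-# OPTIONS --safe #-}

-- The algorithm maintains that M is a matching, that unmatched B-vertices have
-- counter 0, and that c(b) ≤ c(b′) + 1 whenever ab ∈ M and ab′ ∈ E.  Let
-- a₀ b₁ a₁ b₂ … a_k b_{k+1} be an augmenting path.  Reading it backwards,
-- c(b_{k+1}) = 0 and c(b_i) ≤ c(b_{i+1}) + 1, so c_min(a₀) ≤ c(b₁) ≤ k.
-- Hence a path whose start a has c_min(a) ≥ k contains at least k + 1 edges of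
-- OPT.  Walking back from a common vertex along M and OPT, two such paths that
-- meet have the same start, and a start determines the path; so the OPT-edges
-- of distinct paths are distinct, and there are at most |OPT| of them.
module Submission where

open import Defs
open import Data.Bool.Base using (true; false)
open import Data.Empty using (⊥-elim)
open import Data.Fin.Base using (Fin)
open import Data.Fin.Properties as Fin
  using (any?; remQuot-combine; combine-remQuot; combine-injectiveʳ)
open import Data.Fin.Subset using (Subset; _∈_; _∉_; _─_; ∣_∣)
open import Data.Fin.Subset.Properties
  using (_∈?_; ∉⊥; x∈p∪q⁻; x∈p∪q⁺; p─q⊆p; x∈p∧x≢y⇒x∈p-y; x∈p⇒∣p-x∣<∣p∣)
open import Data.List.Base using (List; []; _∷_; map; concat; length; initLast; _∷ʳ′_)
open import Data.List.Membership.Propositional using () renaming (_∈_ to _∈ₗ_)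
open import Data.List.Membership.Propositional.Properties
  using (∈-map⁺; ∈-filter⁺; ∈-allFin)
open import Data.List.NonEmpty.Base using (List⁺; _∷_; last; toList)
open import Data.List.Properties using (length-++; length-map)
open import Data.List.Relation.Binary.Disjoint.Propositional using (Disjoint)
open import Data.List.Relation.Unary.All as All using (All; []; _∷_)
import Data.List.Relation.Unary.All.Properties as All
open import Data.List.Relation.Unary.AllPairs using (AllPairs; []; _∷_)
import Data.List.Relation.Unary.AllPairs.Properties as AllPairs
open import Data.List.Relation.Unary.Any as Any using (here; there)
open import Data.List.Relation.Unary.Unique.Propositional using (Unique)
import Data.List.Relation.Unary.Unique.Propositional.Properties as Unique
open import Data.Nat.Base using (ℕ; suc; _+_; _*_; _≤_; _<_; z≤n; s≤s; s≤s⁻¹)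
open import Data.Nat.Properties
  using (_≟_; ≤-totalOrder; ≤-reflexive; ≤-refl; ≤-trans; ≤-<-trans; +-mono-≤; m≤n⇒m≤1+n;
         *-suc; *-comm; *-cancelˡ-≡; +-comm; module ≤-Reasoning)
open import Data.List.Extrema ≤-totalOrder using (min≤v⁺)
open import Data.Product.Base using (_×_; _,_; ∃; proj₁; proj₂)
open import Data.Rational.Base using (ℚ; Positive)
open import Data.Sum.Base using (_⊎_; inj₁; inj₂)
open import Data.Vec.Properties using (lookup∘tabulate; lookup⇒[]=; []=⇒lookup)
open import Function.Base using (_∘_)
open import Relation.Binary.PropositionalEquality
  using (_≡_; _≢_; refl; sym; trans; cong; subst; subst₂; module ≡-Reasoning)
open import Relation.Nullary.Decidable using (Dec; does; yes; no; dec-true; _×-dec_; ¬?)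
open import Relation.Nullary.Negation using (contradiction)

-- Comprehensions, minima and counting with repetition-free lists.

comprehension⁺ : ∀ {n} {P : Fin n → Set} (P? : ∀ i → Dec (P i)) {i} →
                 P i → i ∈ comprehension P?
comprehension⁺ P? {i} p =
  lookup⇒[]= i _ (trans (lookup∘tabulate (does ∘ P?) i) (dec-true (P? i) p))

comprehension⁻ : ∀ {n} {P : Fin n → Set} (P? : ∀ i → Dec (P i)) {i} →
                 i ∈ comprehension P? → P i
comprehension⁻ P? {i} i∈
  with P? i | trans (sym (lookup∘tabulate (does ∘ P?) i)) ([]=⇒lookup i∈)
... | yes p | _  = p
... | no _  | ()

minimum-≤ : ∀ {x xs} → x ∈ₗ xs → minimum xs ≤ x
minimum-≤ {xs = y ∷ ys} (here refl)  = min≤v⁺ y ys (inj₁ ≤-refl)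
minimum-≤ {xs = y ∷ ys} (there x∈ys) =
  min≤v⁺ y ys (inj₂ (Any.map (≤-reflexive ∘ sym) x∈ys))

-- Induction by deleting the head from `S`: the tail stays inside because the list has no
-- repetitions, and the cardinality drops strictly.
length-≤-∣∣ : ∀ {n} {S : Subset n} {xs} → Unique xs → All (_∈ S) xs →
              length xs ≤ ∣ S ∣
length-≤-∣∣ []            []           = z≤n
length-≤-∣∣ (x∉xs ∷ xs!) (x∈S ∷ xs⊆S) = ≤-<-trans
  (length-≤-∣∣ xs! (All.zipWith (λ (x≢y , y∈S) → x∈p∧x≢y⇒x∈p-y y∈S (x≢y ∘ sym))
                                (x∉xs , xs⊆S)))
  (x∈p⇒∣p-x∣<∣p∣ x∈S)

length-concat-≥ : ∀ {A : Set} {m} {xss : List (List A)} →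
                  All (λ xs → m ≤ length xs) xss → length xss * m ≤ length (concat xss)
length-concat-≥ []                             = z≤n
length-concat-≥ {xss = xs ∷ xss} (m≤ ∷ m≤s) =
  ≤-trans (+-mono-≤ m≤ (length-concat-≥ m≤s)) (≤-reflexive (sym (length-++ xs)))

-- Lets the implication from `R` to `S` draw on `Q` at both elements; distinct paths have disjoint
-- edges because both are augmenting.
allPairs-map-All : ∀ {A : Set} {Q : A → Set} {R S : A → A → Set} →
                   (∀ {x y} → Q x → Q y → R x y → S x y) →
                   ∀ {xs} → All Q xs → AllPairs R xs → AllPairs S xs
allPairs-map-All f []         []         = []
allPairs-map-All f (qx ∷ qxs) (rx ∷ rxs) =
  All.zipWith (λ (qy , r) → f qx qy r) (qxs , rx) ∷ allPairs-map-All f qxs rxs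

last-∷ : ∀ {A : Set} (x y : A) ys → last (x ∷ y ∷ ys) ≡ last (y ∷ ys)
last-∷ x y ys with initLast ys
... | []       = refl
... | zs ∷ʳ′ z = refl

-- Edges, their ends, and vertex-disjointness.

module ALTProperties (G : BipartiteGraph) where
  open BipartiteGraph G
  open ALT G

  endA-edge : ∀ a b → endA (edge a b) ≡ a
  endA-edge a b = cong proj₁ (remQuot-combine a b)

  endB-edge : ∀ a b → endB (edge a b) ≡ b
  endB-edge a b = cong proj₂ (remQuot-combine a b)

  edge-ends : ∀ e → edge (endA e) (endB e) ≡ e
  edge-ends e = combine-remQuot {nA} nB e

  edge-∈-A⟨⟩ : ∀ {N a b} → edge a b ∈ N → a ∈ A⟨ N ⟩
  edge-∈-A⟨⟩ {N} {a} {b} e∈N =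
    comprehension⁺ (λ a → any? λ b → edge a b ∈? N) (b , e∈N)

  edge-∈-B⟨⟩ : ∀ {N a b} → edge a b ∈ N → b ∈ B⟨ N ⟩
  edge-∈-B⟨⟩ {N} {a} {b} e∈N =
    comprehension⁺ (λ b → any? λ a → edge a b ∈? N) (a , e∈N)

  ∈-B⟨⟩⁻ : ∀ {N b} → b ∈ B⟨ N ⟩ → ∃ λ a → edge a b ∈ N
  ∈-B⟨⟩⁻ {N} = comprehension⁻ (λ b → any? λ a → edge a b ∈? N)

  endA-∈ : ∀ {N e} → e ∈ N → endA e ∈ A⟨ N ⟩
  endA-∈ {N} {e} e∈N = edge-∈-A⟨⟩ (subst (_∈ N) (sym (edge-ends e)) e∈N)

  endB-∈ : ∀ {N e} → e ∈ N → endB e ∈ B⟨ N ⟩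
  endB-∈ {N} {e} e∈N = edge-∈-B⟨⟩ (subst (_∈ N) (sym (edge-ends e)) e∈N)

  disjoint⇒sameB : ∀ {N a b b′} → VertexDisjoint N →
                   edge a b ∈ N → edge a b′ ∈ N → b ≡ b′
  disjoint⇒sameB {a = a} {b} {b′} dis ab∈N ab′∈N with edge a b Fin.≟ edge a b′
  ... | yes eq = combine-injectiveʳ a b a b′ eq
  ... | no ≢   = contradiction (trans (endA-edge a b) (sym (endA-edge a b′)))
                               (proj₁ (dis ab∈N ab′∈N ≢))

  disjoint⇒sameA : ∀ {N a a′ b} → VertexDisjoint N →
                   edge a b ∈ N → edge a′ b ∈ N → a ≡ a′
  disjoint⇒sameA {a = a} {a′} {b} dis ab∈N a′b∈N with edge a b Fin.≟ edge a′ b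
  ... | yes eq = Fin.combine-injectiveˡ a b a′ b eq
  ... | no ≢   = contradiction (trans (endB-edge a b) (sym (endB-edge a′ b)))
                               (proj₂ (dis ab∈N a′b∈N ≢))

  cmin-≤ : ∀ c {a b} → edge a b ∈ E → cmin c a ≤ c b
  cmin-≤ c {a} {b} ab∈E = minimum-≤
    (∈-map⁺ c (∈-filter⁺ (_∈? Γ a) (∈-allFin b)
      (comprehension⁺ (λ b → edge a b ∈? E) ab∈E)))

  -- The invariant and its preservation by a round.

  record Invariant (s : State) : Set where
    open State s
    field
      isMatching : IsMatching E M
      fresh      : ∀ {b} → b ∉ B⟨ M ⟩ → c b ≡ 0
      -- Stated for every neighbour `b′` instead of through `cmin`, so that the minimum enters the
      -- proof only as a lower bound.
      nearMin    : ∀ {a b b′} → edge a b ∈ M → edge a b′ ∈ E → c b ≤ suc (c b′)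

  initial-invariant : Invariant initial
  initial-invariant = record
    { isMatching = (⊥-elim ∘ ∉⊥) , (⊥-elim ∘ ∉⊥)
    ; fresh      = λ _ → refl
    ; nearMin    = λ _ _ → z≤n
    }

  module Update {M : EdgeSet} {c : Counter} {N : EdgeSet}
                (N-matching : IsMatching (candidates ⟨ M , c ⟩) N)
                (inv : Invariant ⟨ M , c ⟩) where
    open Invariant inv
    open State (update ⟨ M , c ⟩ N) renaming (M to M′; c to c′)

    kept? = λ e → e ∈? M ×-dec ¬? (endB e ∈? B⟨ N ⟩)

    ∈N⁻ : ∀ {e} → e ∈ N → e ∈ E × endA e ∉ A⟨ M ⟩ × c (endB e) ≡ cmin c (endA e)
    ∈N⁻ e∈N = comprehension⁻
      (λ e → e ∈? E ×-dec ¬? (endA e ∈? A⟨ M ⟩) ×-dec c (endB e) ≟ cmin c (endA e))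
      (proj₁ N-matching e∈N)

    ∈M′⁻ : ∀ {e} {X : Set} → (e ∈ M → endB e ∉ B⟨ N ⟩ → X) → (e ∈ N → X) →
           e ∈ M′ → X
    ∈M′⁻ kept new e∈M′ with x∈p∪q⁻ (comprehension kept?) N e∈M′
    ... | inj₁ e∈  = let e∈M , b∉ = comprehension⁻ kept? e∈ in kept e∈M b∉
    ... | inj₂ e∈N = new e∈N

    -- The mixed case is a kept edge against a new one: they differ in A because candidates start at
    -- unmatched A-vertices, and in B because kept edges avoid `B⟨ N ⟩`.
    M′-disjoint : VertexDisjoint M′
    M′-disjoint {e} {f} e∈M′ f∈M′ e≢f = ∈M′⁻
      (λ e∈M e∉ → ∈M′⁻
        (λ f∈M _ → proj₂ isMatching e∈M f∈M e≢f)
        (λ f∈N → (λ eq → proj₁ (proj₂ (∈N⁻ f∈N)) (subst (_∈ A⟨ M ⟩) eq (endA-∈ e∈M)))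
               , (λ eq → e∉ (subst (_∈ B⟨ N ⟩) (sym eq) (endB-∈ f∈N))))
        f∈M′)
      (λ e∈N → ∈M′⁻
        (λ f∈M f∉ → (λ eq → proj₁ (proj₂ (∈N⁻ e∈N)) (subst (_∈ A⟨ M ⟩) (sym eq) (endA-∈ f∈M)))
                  , (λ eq → f∉ (subst (_∈ B⟨ N ⟩) eq (endB-∈ e∈N))))
        (λ f∈N → proj₂ N-matching e∈N f∈N e≢f)
        f∈M′)
      e∈M′

    c≤c′ : ∀ b → c b ≤ c′ b
    c≤c′ b with does (b ∈? B⟨ N ⟩)
    ... | true  = m≤n⇒m≤1+n ≤-refl
    ... | false = ≤-refl

    c′≤1+c : ∀ b → c′ b ≤ suc (c b)
    c′≤1+c b with does (b ∈? B⟨ N ⟩)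
    ... | true  = ≤-refl
    ... | false = m≤n⇒m≤1+n ≤-refl

    c′≡c : ∀ {b} → b ∉ B⟨ N ⟩ → c′ b ≡ c b
    c′≡c {b} b∉ with b ∈? B⟨ N ⟩
    ... | yes b∈ = contradiction b∈ b∉
    ... | no _   = refl

    -- A matched B-vertex stays matched, since its edge is dropped only when `N` supplies another.
    -- So a vertex free after the round was free before it, and its counter did not move.
    fresh′ : ∀ {b} → b ∉ B⟨ M′ ⟩ → c′ b ≡ 0
    fresh′ {b} b∉M′ = trans (c′≡c b∉N) (fresh b∉M)
      where
      b∉N : b ∉ B⟨ N ⟩
      b∉N b∈N = b∉M′ (edge-∈-B⟨⟩ (x∈p∪q⁺ (inj₂ (proj₂ (∈-B⟨⟩⁻ b∈N)))))
      b∉M : b ∉ B⟨ M ⟩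
      b∉M b∈M with a , ab∈M ← ∈-B⟨⟩⁻ b∈M = b∉M′ (edge-∈-B⟨⟩ (x∈p∪q⁺ (inj₁
        (comprehension⁺ kept? (ab∈M , subst (_∉ B⟨ N ⟩) (sym (endB-edge a b)) b∉N)))))

    nearMin′ : ∀ {a b b′} → edge a b ∈ M′ → edge a b′ ∈ E → c′ b ≤ suc (c′ b′)
    nearMin′ {a} {b} {b′} ab∈M′ ab′∈E = ∈M′⁻
      -- Kept edge: the counter of `b` stands still, while that of `b′` can only grow.
      (λ ab∈M b∉ → begin
        c′ b        ≡⟨ c′≡c (subst (_∉ B⟨ N ⟩) (endB-edge a b) b∉) ⟩
        c b         ≤⟨ nearMin ab∈M ab′∈E ⟩
        suc (c b′)  ≤⟨ s≤s (c≤c′ b′) ⟩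
        suc (c′ b′) ∎)
      -- New edge: `b` had the least counter around `a` before the round and gains at most one.
      (λ ab∈N → begin
        c′ b             ≤⟨ c′≤1+c b ⟩
        suc (c b)        ≡⟨ cong suc (subst₂ (λ y x → c y ≡ cmin c x) (endB-edge a b) (endA-edge a b)
                                             (proj₂ (proj₂ (∈N⁻ ab∈N)))) ⟩
        suc (cmin c a)   ≤⟨ s≤s (cmin-≤ c ab′∈E) ⟩
        suc (c b′)       ≤⟨ s≤s (c≤c′ b′) ⟩
        suc (c′ b′)      ∎)
      ab∈M′
      where open ≤-Reasoning

    invariant′ : Invariant (update ⟨ M , c ⟩ N)
    invariant′ = record
      { isMatching = ∈M′⁻ (λ e∈M _ → proj₁ isMatching e∈M) (proj₁ ∘ ∈N⁻) , M′-disjoint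
      ; fresh      = fresh′
      ; nearMin    = nearMin′
      }

  invariant : ∀ {ε} .{{_ : Positive ε}} {r s} → AtBeginning ε r s → Invariant s
  invariant (start _)                = initial-invariant
  invariant (round exec (N-m , _) _) = Update.invariant′ N-m (invariant exec)

  -- Augmenting paths as walks, and the counters along them.

  module Paths {s : State} (inv : Invariant s)
               {OPT : EdgeSet} (OPT-matching : IsMatching E OPT) where
    open State s
    open Invariant inv

    -- An augmenting path read from its A-end. That the start is unmatched is kept apart, so that
    -- the tail from each later A-vertex, which is matched, is again a walk.
    data Walk : List Vertex → Set where
      end  : ∀ {a b} → edge a b ∈ OPT → b ∉ B⟨ M ⟩ → Walk (inj₁ a ∷ inj₂ b ∷ [])
      step : ∀ {a b a′ vs} → edge a b ∈ OPT → edge a′ b ∈ M →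
             Walk (inj₁ a′ ∷ vs) → Walk (inj₁ a ∷ inj₂ b ∷ inj₁ a′ ∷ vs)

    -- Defined on bare vertex sequences, since `lemma1` counts lists of these.
    oddEdges : List Vertex → List (Fin (nA * nB))
    oddEdges (inj₁ a ∷ inj₂ b ∷ vs) = edge a b ∷ oddEdges vs
    oddEdges _                      = []

    augmenting⇒Walk : ∀ {p a} → IsAugmentingPath M OPT p → StartsAt p a →
                      a ∉ A⟨ M ⟩ × Walk (toList p)
    augmenting⇒Walk {_ ∷ vs} {a} aug refl =
      headUnmatched , fromHead vs endsDistinct lastUnmatched alternates
      where
      open IsAugmentingPath aug
      walk : ∀ a v vs → Alternates (OPT ─ M) (M ─ OPT) (inj₁ a ∷ v ∷ vs) →
             Unmatched M (last (inj₁ a ∷ v ∷ vs)) → Walk (inj₁ a ∷ v ∷ vs)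
      walk a (inj₂ b) [] (ab ∷ _) un = end (p─q⊆p OPT M ab) un
      -- A path stopping in A would arrive by an edge of `M`, so its last vertex would be matched.
      walk a (inj₂ b) (inj₁ a′ ∷ []) (ab ∷ a′b ∷ _) un =
        contradiction (edge-∈-A⟨⟩ (p─q⊆p M OPT a′b)) un
      walk a (inj₂ b) (inj₁ a′ ∷ v ∷ vs) (ab ∷ a′b ∷ alt) un =
        step (p─q⊆p OPT M ab) (p─q⊆p M OPT a′b)
          (walk a′ v vs alt (subst (Unmatched M)
            (trans (last-∷ _ _ (inj₁ a′ ∷ v ∷ vs)) (last-∷ _ _ (v ∷ vs))) un))
      fromHead : ∀ vs → inj₁ a ≢ last (inj₁ a ∷ vs) → Unmatched M (last (inj₁ a ∷ vs)) →
                 Alternates (OPT ─ M) (M ─ OPT) (inj₁ a ∷ vs) ⊎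
                 Alternates (M ─ OPT) (OPT ─ M) (inj₁ a ∷ vs) → Walk (inj₁ a ∷ vs)
      fromHead []           ≢last _  _                = contradiction refl ≢last
      fromHead (v ∷ vs)     _     un (inj₁ alt)       = walk a v vs alt un
      -- The start is unmatched, so the first edge cannot lie in `M`.
      fromHead (inj₂ b ∷ _) _     _  (inj₂ (ab ∷ _))  =
        contradiction (edge-∈-A⟨⟩ (p─q⊆p M OPT ab)) headUnmatched

    length-Walk : ∀ {vs} → Walk vs → length vs ≡ 2 * length (oddEdges vs)
    length-Walk (end _ _)              = refl
    length-Walk (step {vs = vs} _ _ w) =
      trans (cong (2 +_) (length-Walk w)) (sym (*-suc 2 _))

    -- Induction from the far end: the last B-vertex has counter 0 by `fresh`, and `nearMin` allows
    -- a rise of at most one per OPT-edge going back.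
    firstCounter : ∀ {a vs} → Walk (inj₁ a ∷ vs) →
                   ∃ λ b → edge a b ∈ E × c b < length (oddEdges (inj₁ a ∷ vs))
    firstCounter (end {b = b} ab∈OPT b∉M) =
      b , proj₁ OPT-matching ab∈OPT , s≤s (≤-reflexive (fresh b∉M))
    firstCounter (step {b = b} ab∈OPT a′b∈M w) with _ , a′b′∈E , c< ← firstCounter w =
      b , proj₁ OPT-matching ab∈OPT , s≤s (≤-trans (nearMin a′b∈M a′b′∈E) c<)

    cmin<length : ∀ {a vs} → Walk (inj₁ a ∷ vs) →
                  cmin c a < length (oddEdges (inj₁ a ∷ vs))
    cmin<length w with _ , ab∈E , c< ← firstCounter w = ≤-<-trans (cmin-≤ c ab∈E) c<

    oddEdges-∈ : ∀ {vs} → Walk vs → All (_∈ OPT) (oddEdges vs)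
    oddEdges-∈ (end ab _)    = ab ∷ []
    oddEdges-∈ (step ab _ w) = ab ∷ oddEdges-∈ w

    All-endA : ∀ {P : Vertex → Set} {vs} → Walk vs → All P vs →
               All (P ∘ inj₁ ∘ endA) (oddEdges vs)
    All-endA {P} (end {a} {b} _ _) (pa ∷ _) = subst (P ∘ inj₁) (sym (endA-edge a b)) pa ∷ []
    All-endA {P} (step {a} {b} _ _ w) (pa ∷ _ ∷ ps) =
      subst (P ∘ inj₁) (sym (endA-edge a b)) pa ∷ All-endA w ps

    -- The A-ends of these edges are distinct vertices of the path.
    oddEdges-unique : ∀ {vs} → Walk vs → Unique vs → Unique (oddEdges vs)
    oddEdges-unique (end _ _) _ = [] ∷ []
    oddEdges-unique (step {a} {b} _ _ w) ((_ ∷ a∉) ∷ _ ∷ vs!) =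
      All.map (λ a≢ eq → a≢ (cong inj₁ (trans (sym (endA-edge a b)) (cong endA eq))))
              (All-endA w a∉)
      ∷ oddEdges-unique w vs!

    -- Distinct augmenting paths share no OPT-edge.

    data Reaches (a₀ : Fin nA) : Fin nA → Set where
      here : Reaches a₀ a₀
      next : ∀ {a b a′} → Reaches a₀ a → edge a b ∈ OPT → edge a′ b ∈ M → Reaches a₀ a′

    -- Going back is deterministic: `M` fixes the B-vertex before `a`, and `OPT` fixes the A-vertex
    -- before that. The way back can stop only at an unmatched vertex, so both stop together.
    source-unique : ∀ {a₀ a₁ a} → a₀ ∉ A⟨ M ⟩ → a₁ ∉ A⟨ M ⟩ →
                    Reaches a₀ a → Reaches a₁ a → a₀ ≡ a₁
    source-unique a₀∉ a₁∉ here           here           = refl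
    source-unique a₀∉ a₁∉ here           (next _ _ e∈M) = contradiction (edge-∈-A⟨⟩ e∈M) a₀∉
    source-unique a₀∉ a₁∉ (next _ _ e∈M) here           = contradiction (edge-∈-A⟨⟩ e∈M) a₁∉
    source-unique a₀∉ a₁∉ (next r₀ ab ∈M) (next r₁ a′b′ ∈M′)
      with refl ← disjoint⇒sameB (proj₂ isMatching) ∈M ∈M′
      with refl ← disjoint⇒sameA (proj₂ OPT-matching) ab a′b′ = source-unique a₀∉ a₁∉ r₀ r₁

    oddEdges-reached : ∀ {a₀ a vs} → Reaches a₀ a → Walk (inj₁ a ∷ vs) →
                       All (Reaches a₀ ∘ endA) (oddEdges (inj₁ a ∷ vs))
    oddEdges-reached {a₀} r (end {a} {b} _ _) =
      subst (Reaches a₀) (sym (endA-edge a b)) r ∷ []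
    oddEdges-reached {a₀} r (step {a} {b} ab a′b w) =
      subst (Reaches a₀) (sym (endA-edge a b)) r ∷ oddEdges-reached (next r ab a′b) w

    -- Going forward is deterministic too. If one walk ended where the other continues, its last
    -- B-vertex would be matched by the next edge of the other.
    walk-determined : ∀ {a vs ws} → Walk (inj₁ a ∷ vs) → Walk (inj₁ a ∷ ws) → vs ≡ ws
    walk-determined (end ab b∉) (end ab′ _)
      with refl ← disjoint⇒sameB (proj₂ OPT-matching) ab ab′ = refl
    walk-determined (end ab b∉) (step ab′ a′b _)
      with refl ← disjoint⇒sameB (proj₂ OPT-matching) ab ab′ =
      contradiction (edge-∈-B⟨⟩ a′b) b∉
    walk-determined (step ab a′b _) (end ab′ b∉)
      with refl ← disjoint⇒sameB (proj₂ OPT-matching) ab ab′ =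
      contradiction (edge-∈-B⟨⟩ a′b) b∉
    walk-determined (step ab a′b w) (step ab′ a″b w′)
      with refl ← disjoint⇒sameB (proj₂ OPT-matching) ab ab′
      with refl ← disjoint⇒sameA (proj₂ isMatching) a′b a″b =
      cong (λ vs → _ ∷ _ ∷ vs) (walk-determined w w′)

    -- The two bounds.

    path-bound : ∀ k {p a} → IsAugmentingPath M OPT p → pathLength p ≡ 2 * k + 1 →
                 StartsAt p a → cmin c a ≤ k
    path-bound k {p@(_ ∷ _)} {a} aug len refl = s≤s⁻¹ (subst (cmin c a <_)
      -- A path with 2k + 1 edges has 2k + 2 vertices, two for each OPT-edge, hence k + 1 OPT-edges.
      (*-cancelˡ-≡ _ _ 2 (begin
        2 * length (oddEdges (toList p)) ≡⟨ length-Walk w ⟨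
        suc (pathLength p)               ≡⟨ cong suc len ⟩
        suc (2 * k + 1)                  ≡⟨ cong suc (+-comm (2 * k) 1) ⟩
        2 + 2 * k                        ≡⟨ *-suc 2 k ⟨
        2 * suc k                        ∎))
      (cmin<length w))
      where
      open ≡-Reasoning
      w = proj₂ (augmenting⇒Walk aug refl)

    IsLong : ℕ → List⁺ Vertex → Set
    IsLong k p = IsAugmentingPath M OPT p × ∃ λ a → StartsAt p a × a ∈ A⟨ OPT ⟩ × k ≤ cmin c a

    -- The A-end of a shared edge is reached from both starts, so the starts agree, and then so do
    -- the paths.
    oddEdges-disjoint : ∀ {k p q} → IsLong k p → IsLong k q → p ≢ q →
                        Disjoint (oddEdges (toList p)) (oddEdges (toList q))
    oddEdges-disjoint {p = _ ∷ vs} {q = _ ∷ ws}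
      (augp , _ , refl , _) (augq , _ , refl , _) p≢q (e∈p , e∈q)
      with a∉ , wp ← augmenting⇒Walk augp refl
      with a′∉ , wq ← augmenting⇒Walk augq refl
      with refl ← source-unique a∉ a′∉ (All.lookup (oddEdges-reached here wp) e∈p)
                                       (All.lookup (oddEdges-reached here wq) e∈q)
      = p≢q (cong (_ ∷_) (walk-determined wp wq))

    paths-bound : ∀ k (ps : List (List⁺ Vertex)) → Unique ps → All (IsLong k) ps →
                  suc k * length ps ≤ ∣ OPT ∣
    paths-bound k ps ps! longs = begin
      suc k * length ps                ≡⟨ *-comm (suc k) (length ps) ⟩
      length ps * suc k                ≡⟨ cong (_* suc k) (length-map edgesOf ps) ⟨
      -- Double count of the concatenated OPT-edges: at least k + 1 from each path, and no
      -- repetitions within `OPT`.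
      length (map edgesOf ps) * suc k  ≤⟨ length-concat-≥ (All.map⁺ (All.map long longs)) ⟩
      length (concat (map edgesOf ps)) ≤⟨ length-≤-∣∣ edges! (All.concat⁺ (All.map⁺ (All.map inOPT longs))) ⟩
      ∣ OPT ∣                          ∎
      where
      open ≤-Reasoning
      edgesOf : List⁺ Vertex → List (Fin (nA * nB))
      edgesOf = oddEdges ∘ toList
      long : ∀ {p} → IsLong k p → suc k ≤ length (edgesOf p)
      long {_ ∷ _} (aug , _ , refl , _ , k≤) =
        ≤-<-trans k≤ (cmin<length (proj₂ (augmenting⇒Walk aug refl)))
      inOPT : ∀ {p} → IsLong k p → All (_∈ OPT) (edgesOf p)
      inOPT (aug , _ , st , _) = oddEdges-∈ (proj₂ (augmenting⇒Walk aug st))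
      unique : ∀ {p} → IsLong k p → Unique (edgesOf p)
      unique (aug , _ , st , _) =
        oddEdges-unique (proj₂ (augmenting⇒Walk aug st)) (proj₂ (IsAugmentingPath.isPath aug))
      edges! : Unique (concat (map edgesOf ps))
      edges! = Unique.concat⁺ (All.map⁺ (All.map unique longs))
        (AllPairs.map⁺ (allPairs-map-All {S = λ p q → Disjoint (edgesOf p) (edgesOf q)}
          oddEdges-disjoint longs ps!))

-- The second bound is cleared of its denominator, and a set of paths is a repetition-free list.
lemma1 : (G : BipartiteGraph) → let open ALT G in
    (OPT : EdgeSet) → IsMaximumMatching (BipartiteGraph.E G) OPT →
    (ε : ℚ) .{{_ : Positive ε}} (r : ℕ) (s : State) → AtBeginning ε r s →
    let open State s in
    (k : ℕ) →
    (∀ (p : List⁺ Vertex) a₀ → IsAugmentingPath M OPT p →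
    pathLength p ≡ 2 * k + 1 → StartsAt p a₀ → a₀ ∈ A⟨ OPT ⟩ →
    cmin c a₀ ≤ k)
    ×
    (∀ (ps : List (List⁺ Vertex)) → Unique ps →
    All (λ p → IsAugmentingPath M OPT p ×
    ∃ λ a → StartsAt p a × a ∈ A⟨ OPT ⟩ × k ≤ cmin c a) ps →
    suc k * length ps ≤ ∣ OPT ∣)
lemma1 G OPT (OPT-matching , _) ε r s exec k =
  (λ p a₀ aug len st _ → path-bound k aug len st) , paths-bound k
  where open ALTProperties G
        open Paths (invariant exec) OPT-matching
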